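{- Let $G=(V,E)$ be a forest with components $(V_1,E_1),\dots,(V_r,E_r)$, $r\ge 2$, and consider a metric instance as described in the context. Let $u$ be a leaf of the tree $(V_1,E_1)$. If a feasible solution exists, then there exists an optimal solution $F$ such that for every link $f\in F$ between $u$ and a node $v$, we have $v\in R\cup\mathcal{S}_u$.
   Context: Isolated nodes count as components. Let $p\ge1$ be an integer. The link set $E^*$ contains, for every two distinct nodes $u,v$ and every $t\in\{1,\dots,p\}$, exactly one link between $u$ and $v$ of weight $w=t$ (a "$t$-link"), with cost $c\in\mathbb{R}_+\cup\{\infty\}$; $(a,b)$ denotes a link between $a$ and $b$. A feasible solution is a multiset $F$ of links (a link may be taken several times) with $w(F)\le p$ (counted with multiplicity) such that $(V,E\cup F)$ is 2-edge-connected; optimal means minimizing $c(F)$. A link is internal if its endpoints lie in the same component, external otherwise; for an internal link $f$, $P(f)$ is the path in that component between its endpoints. A leaf is a node of degree 1 in $G$. For a leaf $u\in V_i$, a component $V_j$ with $j\ne i$ and $1\le t\le p$, $S_t(u,V_j)$ is a fixed (arbitrarily tie-broken) node $z\in V_j$ such that some link between $u$ and $z$ of weight at most $t$ has minimum cost among all links between $u$ and nodes of $V_j$ of weight at most $t$. An external link $f=(u,v)$ with $u$ a leaf and $v\in V_j$ is foliate (with respect to $u$), and $P_u(f)$ is the path in $E_j$ between $v$ and $S_{w(f)}(u,V_j)$. A link $f$ is a shadow of a link $e$ if $w(f)\ge w(e)$ and either $e=f$; or $e,f$ are internal links in the same component with $P(f)\subseteq P(e)$; or $e=(u,x)$, $f=(u,y)$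 are external links with $u$ a leaf and $P_u(f)\subseteq P_u(e)$. The instance is metric if (i) $c(f)\le c(e)$ whenever $f$ is a shadow of $e$, and (ii) for any links $e=(u,v)$, $f=(v,z)$, $h=(u,z)$ with $w(h)\ge w(e)+w(f)$, $c(h)\le c(e)+c(f)$. $R$ is the set of nodes whose degree in $G$ is not 2, and $\mathcal{S}_u=\{S_t(u,V_j): 1\le t\le p,\ 2\le j\le r\}$. -}

module Defs where

open import Data.Nat using (ℕ; zero; suc; _+_; _≤_)
open import Data.Fin using (Fin)
open import Data.Fin.Properties using (_≟_)
open import Data.Bool using (Bool; true; false; _∨_; if_then_else_)
open import Data.List using (List; []; _∷_; _++_; map; length; lookup; removeAt; foldr)
open import Data.List.Membership.Propositional using (_∈_)
open import Data.List.Relation.Unary.All using (All)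
open import Data.List.Relation.Unary.Unique.Propositional using (Unique)
open import Data.Product using (_×_; _,_; proj₁; proj₂; ∃; Σ; swap)
open import Data.Sum using (_⊎_)
open import Relation.Nullary using (¬_)
open import Relation.Nullary.Decidable using (⌊_⌋)
open import Relation.Binary.PropositionalEquality using (_≡_; _≢_)

record CostMonoid : Set₁ where
  field
    Carrier   : Set
    _≼_       : Carrier → Carrier → Set
    _⊕_       : Carrier → Carrier → Carrier
    𝟘         : Carrier
    ≼-refl    : ∀ x → x ≼ x
    ≼-trans   : ∀ {x y z} → x ≼ y → y ≼ z → x ≼ z
    ≼-total   : ∀ x y → (x ≼ y) ⊎ (y ≼ x)
    ⊕-assoc   : ∀ x y z → (x ⊕ y) ⊕ z ≡ x ⊕ (y ⊕ z)
    ⊕-comm    : ∀ x y → x ⊕ y ≡ y ⊕ x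
    ⊕-identityˡ : ∀ x → 𝟘 ⊕ x ≡ x
    ⊕-mono    : ∀ {x y x' y'} → x ≼ x' → y ≼ y' → (x ⊕ y) ≼ (x' ⊕ y')
    𝟘-least   : ∀ x → 𝟘 ≼ x

open CostMonoid public

-- Graphs on node set Fin n, given by a list of (undirected) edges
-- (a list, so that multigraphs E ∪ F are representable).

Edge : ℕ → Set
Edge n = Fin n × Fin n

Graph : ℕ → Set
Graph n = List (Edge n)

Adj : ∀ {n} → Graph n → Fin n → Fin n → Set
Adj E a b = ((a , b) ∈ E) ⊎ ((b , a) ∈ E)

data Walk {n} (E : Graph n) : Fin n → Fin n → List (Fin n) → Set where
  here : ∀ {a} → Walk E a a (a ∷ [])
  step : ∀ {a b c vs} → Adj E a b → Walk E b c vs → Walk E a c (a ∷ vs)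

Reach : ∀ {n} → Graph n → Fin n → Fin n → Set
Reach E a b = ∃ λ vs → Walk E a b vs

Path : ∀ {n} → Graph n → Fin n → Fin n → List (Fin n) → Set
Path E a b vs = Walk E a b vs × Unique vs

pairs : ∀ {A : Set} → List A → List (A × A)
pairs (x ∷ y ∷ xs) = (x , y) ∷ pairs (y ∷ xs)
pairs _            = []

SubPath : ∀ {n} → List (Fin n) → List (Fin n) → Set
SubPath vs ws =
  All (λ v → v ∈ ws) vs ×
  All (λ e → (e ∈ pairs ws) ⊎ (swap e ∈ pairs ws)) (pairs vs)

-- P(a,b) ⊆ P(a',b') for paths in the forest E (paths are unique there)
PathIncl : ∀ {n} → Graph n → Fin n → Fin n → Fin n → Fin n → Set
PathIncl E a b a' b' =
  ∀ vs ws → Path E a b vs → Path E a' b' ws → SubPath vs ws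

Connected : ∀ {n} → Graph n → Set
Connected E = ∀ a b → Reach E a b

TwoEdgeConnected : ∀ {n} → Graph n → Set
TwoEdgeConnected E = Connected E × (∀ i → Connected (removeAt E i))

-- forest: every edge is a bridge (excludes loops, parallel edges, cycles)
IsForest : ∀ {n} → Graph n → Set
IsForest E = ∀ i → ¬ Reach (removeAt E i) (proj₁ (lookup E i)) (proj₂ (lookup E i))

deg : ∀ {n} → Graph n → Fin n → ℕ
deg [] x = 0
deg ((a , b) ∷ E) x = (if ⌊ x ≟ a ⌋ ∨ ⌊ x ≟ b ⌋ then 1 else 0) + deg E x

Leaf : ∀ {n} → Graph n → Fin n → Set
Leaf E x = deg E x ≡ 1

InR : ∀ {n} → Graph n → Fin n → Set
InR E x = ¬ (deg E x ≡ 2)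

Link : ℕ → Set
Link n = Fin n × Fin n × ℕ

ValidLink : ∀ {n} → ℕ → Link n → Set
ValidLink p (a , b , t) = (a ≢ b) × (1 ≤ t) × (t ≤ p)

linkEdge : ∀ {n} → Link n → Edge n
linkEdge (a , b , t) = (a , b)

weight : ∀ {n} → List (Link n) → ℕ
weight [] = 0
weight ((a , b , t) ∷ F) = t + weight F

CostFn : CostMonoid → ℕ → Set
CostFn CM n = Fin n → Fin n → ℕ → Carrier CM

cost : ∀ {n} (CM : CostMonoid) → CostFn CM n → List (Link n) → Carrier CM
cost CM c [] = 𝟘 CM
cost CM c ((a , b , t) ∷ F) = _⊕_ CM (c a b t) (cost CM c F)

SymmetricCost : ∀ {n} (CM : CostMonoid) → ℕ → CostFn CM n → Set
SymmetricCost {n} CM p c = ∀ (a b : Fin n) t → ValidLink p (a , b , t) → c a b t ≡ c b a t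

Feasible : ∀ {n} → ℕ → Graph n → List (Link n) → Set
Feasible p E F =
  All (ValidLink p) F × (weight F ≤ p) × TwoEdgeConnected (E ++ map linkEdge F)

Optimal : ∀ {n} (CM : CostMonoid) → ℕ → Graph n → CostFn CM n → List (Link n) → Set
Optimal CM p E c F =
  Feasible p E F × (∀ F' → Feasible p E F' → _≼_ CM (cost CM c F) (cost CM c F'))

-- S u t y  represents  S_t(u, V_j)  where V_j is the component of y.
-- Specification, for every leaf u, every y outside u's component and
-- every 1 ≤ t ≤ p.

IsSChoice : ∀ {n} (CM : CostMonoid) → ℕ → Graph n → CostFn CM n →
            (Fin n → ℕ → Fin n → Fin n) → Set
IsSChoice {n} CM p E c S =
  ∀ (u y : Fin n) t → Leaf E u → ¬ Reach E u y → 1 ≤ t → t ≤ p →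
    (∀ y' → Reach E y y' → S u t y ≡ S u t y') ×
    Reach E y (S u t y) ×
    (Σ ℕ λ t' → (1 ≤ t') × (t' ≤ t) ×
      (∀ z t'' → Reach E y z → 1 ≤ t'' → t'' ≤ t →
         _≼_ CM (c u (S u t y) t') (c u z t'')))

-- metric (i): c(f) ≤ c(e) whenever f is a shadow of e
-- (the case e = f is trivial by reflexivity)
ShadowInternal : ∀ {n} (CM : CostMonoid) → ℕ → Graph n → CostFn CM n → Set
ShadowInternal {n} CM p E c =
  ∀ (a b a' b' : Fin n) te tf →
    ValidLink p (a , b , te) → ValidLink p (a' , b' , tf) → te ≤ tf →
    Reach E a b → Reach E a' b' → Reach E a a' →
    PathIncl E a' b' a b →
    _≼_ CM (c a' b' tf) (c a b te)

ShadowExternal : ∀ {n} (CM : CostMonoid) → ℕ → Graph n → CostFn CM n →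
                 (Fin n → ℕ → Fin n → Fin n) → Set
ShadowExternal {n} CM p E c S =
  ∀ (u x y : Fin n) te tf → Leaf E u →
    ¬ Reach E u x → ¬ Reach E u y →
    1 ≤ te → te ≤ tf → tf ≤ p →
    PathIncl E y (S u tf y) x (S u te x) →
    _≼_ CM (c u y tf) (c u x te)

Triangle : ∀ {n} (CM : CostMonoid) → ℕ → CostFn CM n → Set
Triangle {n} CM p c =
  ∀ (u v z : Fin n) t₁ t₂ t₃ →
    ValidLink p (u , v , t₁) → ValidLink p (v , z , t₂) → ValidLink p (u , z , t₃) →
    t₁ + t₂ ≤ t₃ →
    _≼_ CM (c u z t₃) (_⊕_ CM (c u v t₁) (c v z t₂))

IsMetric : ∀ {n} (CM : CostMonoid) → ℕ → Graph n → CostFn CM n →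
           (Fin n → ℕ → Fin n → Fin n) → Set
IsMetric CM p E c S =
  ShadowInternal CM p E c × ShadowExternal CM p E c S × Triangle CM p c

InSu : ∀ {n} → ℕ → Graph n → (Fin n → ℕ → Fin n → Fin n) → Fin n → Fin n → Set
InSu {n} p E S u v =
  Σ ℕ λ t → Σ (Fin n) λ y → (1 ≤ t) × (t ≤ p) × ¬ Reach E u y × (v ≡ S u t y)

GoodAt : ∀ {n} → ℕ → Graph n → (Fin n → ℕ → Fin n → Fin n) → Fin n → Link n → Set
GoodAt p E S u (a , b , t) =
  (a ≡ u → InR E b ⊎ InSu p E S u b) × (b ≡ u → InR E a ⊎ InSu p E S u a)

{-# OPTIONS --safe #-}
-- A bad link f = (u , v) has deg v = 2 and v differs from the end u, respectively S_t(u , V_j), of its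
-- path. Let v′ be the next node on that path. Moving f to (u , v′) does not increase the cost. If this
-- destroys 2-edge-connectivity, then vv′ has become a bridge; since deg v = 2, the side of v can only
-- be 2-edge-connected if it contains a link (v , y), and splitting off (u , v) and (v , y) at v into
-- (u , y) gives a feasible solution of no larger cost with fewer links. So, starting from an optimal
-- solution, which exists because there are finitely many candidates, this process ends in a good one.
module Submission where

open import Defs
open import Data.Nat using (ℕ; zero; suc; _+_; _≤_; _<_; z≤n; s≤s; _≤?_)
import Data.Nat.Properties as ℕₚ
open import Algebra.Properties.CommutativeSemigroup ℕₚ.+-commutativeSemigroup using (interchange; x∙yz≈y∙xz)
open import Data.Nat.ListAction using (sum)
open import Data.Nat.ListAction.Properties using (sum-++; sum-↭)
open import Data.Fin using (Fin; zero; suc)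
open import Data.Fin.Properties using (_≟_; all?; ¬∀⟶∃¬)
open import Data.Bool using (Bool; true; false; not; _∧_; _∨_; _xor_; if_then_else_)
open import Data.List using (List; []; _∷_; _++_; map; length; lookup; removeAt; upTo; allFin; filter; cartesianProduct; cartesianProductWith)
open import Data.List.Properties using (map-++; map-cong; ++-identityʳ)
open import Data.List.Membership.Propositional using (_∈_)
open import Data.List.Membership.Propositional.Properties
  using (∈-∃++; ∈-map⁻; ∈-upTo⁺; ∈-allFin; ∈-cartesianProduct⁺; ∈-cartesianProductWith⁺; ∈-filter⁺; ∈-filter⁻; ∈-++⁺ˡ; ∈-++⁺ʳ; ∈-++⁻)
open import Data.List.Relation.Unary.All as All using (All; []; _∷_)
open import Data.List.Relation.Unary.All.Properties using (¬Any⇒All¬)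
open import Data.List.Relation.Unary.Any as Any using (here; there; index)
open import Data.List.Relation.Unary.Any.Properties using (lookup-index)
open import Data.List.Relation.Unary.Unique.Propositional using (Unique)
open import Data.List.Relation.Unary.AllPairs using ([]; _∷_)
open import Data.List.Relation.Binary.Permutation.Propositional as ↭ using (_↭_; ↭-sym)
import Data.List.Relation.Binary.Permutation.Propositional.Properties as ↭ₚ
open import Data.Product using (_×_; _,_; proj₁; proj₂; ∃; ∃₂; Σ)
open import Data.Sum using (_⊎_; inj₁; inj₂; [_,_]′)
import Data.Sum as Sum
open import Data.Empty using (⊥-elim)
open import Function using (_∘_)
open import Relation.Nullary using (¬_; Dec; yes; no; contradiction)
open import Relation.Nullary.Decidable using (⌊_⌋; map′; _×-dec_; _⊎-dec_; ¬?)
open import Relation.Binary.PropositionalEquality using (_≡_; _≢_; refl; sym; trans; cong; cong₂; subst; subst₂)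

-- Sums over lists

total : {A : Set} → (A → ℕ) → List A → ℕ
total g xs = sum (map g xs)

total-++ : {A : Set} (g : A → ℕ) (xs ys : List A) → total g (xs ++ ys) ≡ total g xs + total g ys
total-++ g xs ys = trans (cong sum (map-++ g xs ys)) (sum-++ (map g xs) (map g ys))

total-↭ : {A : Set} (g : A → ℕ) {xs ys : List A} → xs ↭ ys → total g xs ≡ total g ys
total-↭ g p = sum-↭ (↭ₚ.map⁺ g p)

total-removeAt : {A : Set} (g : A → ℕ) (xs : List A) (i : Fin (length xs)) →
                 total g xs ≡ g (lookup xs i) + total g (removeAt xs i)
total-removeAt g (x ∷ xs) zero    = refl
total-removeAt g (x ∷ xs) (suc i) = trans (cong (g x +_) (total-removeAt g xs i))
  (x∙yz≈y∙xz (g x) (g (lookup xs i)) (total g (removeAt xs i)))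

total-mono : {A : Set} {g h : A → ℕ} (xs : List A) → (∀ {x} → x ∈ xs → g x ≤ h x) → total g xs ≤ total h xs
total-mono []       le = z≤n
total-mono (x ∷ xs) le = ℕₚ.+-mono-≤ (le (here refl)) (total-mono xs (le ∘ there))

total≡0 : {A : Set} {g : A → ℕ} (xs : List A) → (∀ {x} → x ∈ xs → g x ≡ 0) → total g xs ≡ 0
total≡0 []       eq = refl
total≡0 (x ∷ xs) eq = cong₂ _+_ (eq (here refl)) (total≡0 xs (eq ∘ there))

total≡0⁻ : {A : Set} {g : A → ℕ} (xs : List A) → total g xs ≡ 0 → ∀ {x} → x ∈ xs → g x ≡ 0
total≡0⁻ {g = g} (x ∷ xs) eq (here refl) = ℕₚ.m+n≡0⇒m≡0 (g x) eq
total≡0⁻ {g = g} (x ∷ xs) eq (there x∈)  = total≡0⁻ xs (ℕₚ.m+n≡0⇒n≡0 (g x) eq) x∈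

total-positive : {A : Set} {g : A → ℕ} (xs : List A) → 1 ≤ total g xs → ∃ λ x → x ∈ xs × 1 ≤ g x
total-positive {g = g} (x ∷ xs) le with g x in eq
... | suc _ = x , here refl , subst (1 ≤_) (sym eq) (s≤s z≤n)
... | zero with y , y∈ , p ← total-positive xs le = y , there y∈ , p

-- Allows two cuts to be charged edge by edge against a third one, as `splitting-off` does.
total-+-≤ : {A : Set} {g h k : A → ℕ} (xs : List A) → (∀ {x} → x ∈ xs → g x + h x ≤ k x) →
            total g xs + total h xs ≤ total k xs
total-+-≤ []       le = z≤n
total-+-≤ {g = g} {h} {k} (x ∷ xs) le =
  subst (_≤ total k (x ∷ xs)) (interchange (g x) (h x) (total g xs) (total h xs))
    (ℕₚ.+-mono-≤ (le (here refl)) (total-+-≤ xs (le ∘ there)))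

∈-removeAt : {A : Set} {x : A} {xs : List A} (i : Fin (length xs)) → x ∈ xs → x ≢ lookup xs i → x ∈ removeAt xs i
∈-removeAt {xs = _ ∷ _} zero    (here eq)  x≢ = contradiction eq x≢
∈-removeAt {xs = _ ∷ _} zero    (there x∈) x≢ = x∈
∈-removeAt {xs = _ ∷ _} (suc i) (here eq)  x≢ = here eq
∈-removeAt {xs = _ ∷ _} (suc i) (there x∈) x≢ = there (∈-removeAt i x∈ x≢)

∈⇒↭∷ : {A : Set} {x : A} {xs : List A} → x ∈ xs → ∃ λ ys → xs ↭ x ∷ ys
∈⇒↭∷ {x = x} x∈ with ys , zs , refl ← ∈-∃++ x∈ = ys ++ zs , ↭ₚ.shift x ys zs

-- Reachability and its decidability

Adj-sym : ∀ {n} {E : Graph n} {a b} → Adj E a b → Adj E b a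
Adj-sym = Sum.swap

Reach-refl : ∀ {n} {E : Graph n} {a} → Reach E a a
Reach-refl = _ , here

Reach-step : ∀ {n} {E : Graph n} {a b c} → Adj E a b → Reach E b c → Reach E a c
Reach-step ab (_ , w) = _ , step ab w

Reach-trans : ∀ {n} {E : Graph n} {a b c} → Reach E a b → Reach E b c → Reach E a c
Reach-trans (_ , here)      bc = bc
Reach-trans (_ , step ab w) bc = Reach-step ab (Reach-trans (_ , w) bc)

Reach-sym : ∀ {n} {E : Graph n} {a b} → Reach E a b → Reach E b a
Reach-sym (_ , here)      = Reach-refl
Reach-sym (_ , step ab w) = Reach-trans (Reach-sym (_ , w)) (Reach-step (Adj-sym ab) Reach-refl)

Reach-mono : ∀ {n} {E E′ : Graph n} → (∀ {e} → e ∈ E → e ∈ E′) → ∀ {a b} → Reach E a b → Reach E′ a b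
Reach-mono i (_ , here)      = Reach-refl
Reach-mono i (_ , step ab w) = Reach-step (Sum.map i i ab) (Reach-mono i (_ , w))

-- A walk needs an added edge at most once, which makes reachability decidable by recursion on the edge list.
module _ {n} {E : Graph n} {x y : Fin n} where

  Via : Fin n → Fin n → Set
  Via a b = Reach E a b ⊎ (Reach E a x × Reach E y b) ⊎ (Reach E a y × Reach E x b)

  Via-step : ∀ {a b c} → Adj ((x , y) ∷ E) a b → Via b c → Via a c
  Via-step (inj₁ (here refl)) (inj₁ yc)              = inj₂ (inj₁ (Reach-refl , yc))
  Via-step (inj₁ (here refl)) (inj₂ (inj₁ (_ , yc))) = inj₂ (inj₁ (Reach-refl , yc))
  -- The walk goes from x over to y and later returns to x; dropping this detour removes both uses
  -- of the new edge.
  Via-step (inj₁ (here refl)) (inj₂ (inj₂ (_ , xc))) = inj₁ xc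
  Via-step (inj₂ (here refl)) (inj₁ xc)              = inj₂ (inj₂ (Reach-refl , xc))
  Via-step (inj₂ (here refl)) (inj₂ (inj₁ (_ , yc))) = inj₁ yc
  Via-step (inj₂ (here refl)) (inj₂ (inj₂ (_ , xc))) = inj₂ (inj₂ (Reach-refl , xc))
  Via-step (inj₁ (there e)) v = let s = λ {d} → Reach-step {c = d} (inj₁ e) in
    Sum.map s (Sum.map (λ (p , q) → s p , q) (λ (p , q) → s p , q)) v
  Via-step (inj₂ (there e)) v = let s = λ {d} → Reach-step {c = d} (inj₂ e) in
    Sum.map s (Sum.map (λ (p , q) → s p , q) (λ (p , q) → s p , q)) v

  Reach⇒Via : ∀ {a b} → Reach ((x , y) ∷ E) a b → Via a b
  Reach⇒Via (_ , here)      = inj₁ Reach-refl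
  Reach⇒Via (_ , step ab w) = Via-step ab (Reach⇒Via (_ , w))

  Via⇒Reach : ∀ {a b} → Via a b → Reach ((x , y) ∷ E) a b
  Via⇒Reach (inj₁ ab) = Reach-mono there ab
  Via⇒Reach (inj₂ (inj₁ (ax , yb))) =
    Reach-trans (Reach-mono there ax) (Reach-step (inj₁ (here refl)) (Reach-mono there yb))
  Via⇒Reach (inj₂ (inj₂ (ay , xb))) =
    Reach-trans (Reach-mono there ay) (Reach-step (inj₂ (here refl)) (Reach-mono there xb))

reach? : ∀ {n} (E : Graph n) a b → Dec (Reach E a b)
reach? []            a b = map′ (λ { refl → Reach-refl }) (λ { (_ , here) → refl ; (_ , step (inj₁ ()) _) ; (_ , step (inj₂ ()) _) }) (a ≟ b)
reach? ((x , y) ∷ E) a b = map′ Via⇒Reach Reach⇒Via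
  (reach? E a b ⊎-dec ((reach? E a x ×-dec reach? E y b) ⊎-dec (reach? E a y ×-dec reach? E x b)))

connected? : ∀ {n} (E : Graph n) → Dec (Connected E)
connected? E = all? λ a → all? λ b → reach? E a b

twoEdgeConnected? : ∀ {n} (E : Graph n) → Dec (TwoEdgeConnected E)
twoEdgeConnected? E = connected? E ×-dec all? λ i → connected? (removeAt E i)

-- Cuts

cr : Bool → Bool → ℕ
cr x y = if x xor y then 1 else 0

crosses : ∀ {n} → (Fin n → Bool) → Edge n → ℕ
crosses X (a , b) = cr (X a) (X b)

δ : ∀ {n} → Graph n → (Fin n → Bool) → ℕ
δ G X = total (crosses X) G

-- The cut form of 2-edge-connectivity. Every modification of a solution is checked in this form,
-- because it only changes a few summands of `δ`.
TwoCut : ∀ {n} → Graph n → Set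
TwoCut G = ∀ X a b → X a ≡ true → X b ≡ false → 2 ≤ δ G X

cr-sym : ∀ x y → cr x y ≡ cr y x
cr-sym true  true  = refl
cr-sym true  false = refl
cr-sym false true  = refl
cr-sym false false = refl

cr-self : ∀ x → cr x x ≡ 0
cr-self true  = refl
cr-self false = refl

cr≡0⇒≡ : ∀ x y → cr x y ≡ 0 → x ≡ y
cr≡0⇒≡ true  true  _ = refl
cr≡0⇒≡ false false _ = refl

-- `not (x xor z)` says that x and z agree. With z the value at a node, this passes to the side of a
-- cut containing that node, at most complementing the cut.
cr-xor : ∀ x y z → cr (not (x xor z)) (not (y xor z)) ≡ cr x y
cr-xor true  true  z     = cr-self (not (not z))
cr-xor false false z     = cr-self (not z)
cr-xor true  false true  = refl
cr-xor true  false false = refl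
cr-xor false true  true  = refl
cr-xor false true  false = refl

infix 4 _≈ᶜ_
-- Comparing graphs only through their cuts ignores the order and orientation of edges, as well as
-- loops.
record _≈ᶜ_ {n} (G H : Graph n) : Set where
  constructor same-cuts
  field δ-cong : ∀ X → δ G X ≡ δ H X
open _≈ᶜ_

≈ᶜ-sym : ∀ {n} {G H : Graph n} → G ≈ᶜ H → H ≈ᶜ G
≈ᶜ-sym eq = same-cuts (sym ∘ δ-cong eq)

≈ᶜ-trans : ∀ {n} {G H K : Graph n} → G ≈ᶜ H → H ≈ᶜ K → G ≈ᶜ K
≈ᶜ-trans eq eq′ = same-cuts λ X → trans (δ-cong eq X) (δ-cong eq′ X)

≈ᶜ-∷ : ∀ {n} {G H : Graph n} {e e′ : Edge n} → (∀ X → crosses X e ≡ crosses X e′) → G ≈ᶜ H → (e ∷ G) ≈ᶜ (e′ ∷ H)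
≈ᶜ-∷ eq eq′ = same-cuts λ X → cong₂ _+_ (eq X) (δ-cong eq′ X)

↭⇒≈ᶜ : ∀ {n} {G H : Graph n} → G ↭ H → G ≈ᶜ H
↭⇒≈ᶜ p = same-cuts λ X → total-↭ (crosses X) p

≈ᶜ-refl : ∀ {n} {G : Graph n} → G ≈ᶜ G
≈ᶜ-refl = same-cuts λ _ → refl

≈ᶜ-++ : ∀ {n} {G H : Graph n} → G ≈ᶜ H → ∀ K → (G ++ K) ≈ᶜ (H ++ K)
≈ᶜ-++ {G = G} {H} eq K = same-cuts λ X →
  trans (total-++ (crosses X) G K) (trans (cong (_+ δ K X) (δ-cong eq X)) (sym (total-++ (crosses X) H K)))

-- Brings a link `e`, followed by the rearranged forest `H`, to the head of the list, where the cut
-- lemmas expect the edges they modify.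
≈ᶜ-front : ∀ {n} {G H : Graph n} → G ≈ᶜ H → ∀ e K → (G ++ e ∷ K) ≈ᶜ (e ∷ H ++ K)
≈ᶜ-front {G = G} eq e K = ≈ᶜ-trans (↭⇒≈ᶜ (↭ₚ.shift e G K)) (≈ᶜ-∷ (λ _ → refl) (≈ᶜ-++ eq K))

TwoCut-resp : ∀ {n} {G H : Graph n} → G ≈ᶜ H → TwoCut G → TwoCut H
TwoCut-resp eq cut X a b Xa Xb = subst (2 ≤_) (δ-cong eq X) (cut X a b Xa Xb)

walk-crosses : ∀ {n} {G : Graph n} {X a b vs} → Walk G a b vs → X a ≡ true → X b ≡ false →
               ∃ λ e → e ∈ G × crosses X e ≡ 1
walk-crosses here Xa Xb with () ← trans (sym Xa) Xb
walk-crosses {X = X} (step {b = b} ab w) Xa Xb with X b in eq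
... | true = walk-crosses w eq Xb
... | false with ab
...   | inj₁ e = _ , e , cong₂ cr Xa eq
...   | inj₂ e = _ , e , cong₂ cr eq Xa

-- The crossing edge is returned as a position, so that a second application, to `removeAt G i`,
-- finds a different one.
connected⇒δ : ∀ {n} {G : Graph n} → Connected G → ∀ {X a b} → X a ≡ true → X b ≡ false →
              Σ (Fin (length G)) λ i → δ G X ≡ suc (δ (removeAt G i) X)
connected⇒δ {G = G} con {X} {a} {b} Xa Xb with e , e∈ , eq ← walk-crosses {X = X} (proj₂ (con a b)) Xa Xb =
  index e∈ , trans (total-removeAt (crosses X) G (index e∈))
    (cong (_+ δ (removeAt G (index e∈)) X) (trans (cong (crosses X) (sym (lookup-index e∈))) eq))

TwoEdgeConnected⇒TwoCut : ∀ {n} {G : Graph n} → TwoEdgeConnected G → TwoCut G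
TwoEdgeConnected⇒TwoCut (con , con₁) X a b Xa Xb
  with i , eq ← connected⇒δ con {X} Xa Xb
  with j , eq′ ← connected⇒δ (con₁ i) {X} Xa Xb
  = subst (2 ≤_) (sym (trans eq (cong suc eq′))) (s≤s (s≤s z≤n))

-- If b cannot be reached from a, the set of nodes reachable from a is left by no edge.
connected-or-cut : ∀ {n} (G : Graph n) → Connected G ⊎
  ∃ λ X → ∃₂ λ a b → X a ≡ true × X b ≡ false × δ G X ≡ 0
connected-or-cut {n} G with connected? G
... | yes con = inj₁ con
... | no ¬con
  with a , ¬a ← ¬∀⟶∃¬ n _ (λ a → all? λ b → reach? G a b) ¬con
  with b , ¬ab ← ¬∀⟶∃¬ n _ (reach? G a) ¬a
  = inj₂ (X , a , b , Xtrue Reach-refl , Xfalse ¬ab , total≡0 G (λ {e} → uncrossed {e}))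
  where
  X : Fin n → Bool
  X c = ⌊ reach? G a c ⌋
  Xtrue : ∀ {c} → Reach G a c → X c ≡ true
  Xtrue {c} r with reach? G a c
  ... | yes _ = refl
  ... | no ¬r = contradiction r ¬r
  Xfalse : ∀ {c} → ¬ Reach G a c → X c ≡ false
  Xfalse {c} ¬r with reach? G a c
  ... | yes r = contradiction r ¬r
  ... | no _  = refl
  uncrossed : ∀ {e} → e ∈ G → crosses X e ≡ 0
  uncrossed {x , y} e∈ with reach? G a x
  ... | yes r = cong (cr true) (Xtrue (Reach-trans r (Reach-step (inj₁ e∈) Reach-refl)))
  ... | no ¬r = cong (cr false) (Xfalse (λ r → ¬r (Reach-trans r (Reach-step (inj₂ e∈) Reach-refl))))

cr≤1 : ∀ x y → cr x y ≤ 1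
cr≤1 true  true  = z≤n
cr≤1 true  false = s≤s z≤n
cr≤1 false true  = s≤s z≤n
cr≤1 false false = z≤n

-- When removing edge i disconnects G, an empty cut of the rest regains at most that one edge in G.
TwoCut-or-cut : ∀ {n} (G : Graph n) → TwoEdgeConnected G ⊎
  ∃ λ X → ∃₂ λ a b → X a ≡ true × X b ≡ false × δ G X ≤ 1
TwoCut-or-cut G with connected-or-cut G
... | inj₂ (X , a , b , Xa , Xb , eq) = inj₂ (X , a , b , Xa , Xb , subst (_≤ 1) (sym eq) z≤n)
... | inj₁ con with all? (λ i → connected? (removeAt G i))
...   | yes con₁ = inj₁ (con , con₁)
...   | no ¬con₁
  with i , ¬i ← ¬∀⟶∃¬ _ _ (λ i → connected? (removeAt G i)) ¬con₁
  with connected-or-cut (removeAt G i)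
...     | inj₁ coni = contradiction coni ¬i
...     | inj₂ (X , a , b , Xa , Xb , eq) = inj₂ (X , a , b , Xa , Xb ,
  subst (_≤ 1) (sym (trans (total-removeAt (crosses X) G i)
                           (trans (cong (crosses X (lookup G i) +_) eq) (ℕₚ.+-identityʳ _))))
    (cr≤1 (X (proj₁ (lookup G i))) (X (proj₂ (lookup G i)))))

TwoCut⇒TwoEdgeConnected : ∀ {n} {G : Graph n} → TwoCut G → TwoEdgeConnected G
TwoCut⇒TwoEdgeConnected {G = G} cut with TwoCut-or-cut G
... | inj₁ tec = tec
... | inj₂ (X , a , b , Xa , Xb , le) = contradiction (ℕₚ.≤-trans (cut X a b Xa Xb) le) λ { (s≤s ()) }

-- Here K is the graph without its edge vv′, which is then the only one crossing B.
record Bridge {n} (K : Graph n) (u v v′ : Fin n) : Set where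
  field
    B    : Fin n → Bool
    Bu   : B u ≡ false
    Bv   : B v ≡ true
    Bv′  : B v′ ≡ false
    none : δ K B ≡ 0

-- Moving uv to uv′ lowers a cut below two only if v is separated from both u and v′. Then vv′ is
-- already the one edge allowed, so the rest contributes nothing.
bridge-cases : ∀ xu xv xv′ {d} → cr xu xv′ + (cr xv xv′ + d) ≤ 1 → 2 ≤ cr xu xv + (cr xv xv′ + d) →
        not (xu xor xv) ≡ false × not (xv′ xor xv) ≡ false × d ≡ 0
bridge-cases true  true  true  (s≤s z≤n) (s≤s ())
bridge-cases false false false (s≤s z≤n) (s≤s ())
bridge-cases true  true  false (s≤s ()) _
bridge-cases false false true  (s≤s ()) _
bridge-cases true  false false le le′ = ⊥-elim (ℕₚ.<-irrefl refl (ℕₚ.≤-trans le′ le))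
bridge-cases false true  true  le le′ = ⊥-elim (ℕₚ.<-irrefl refl (ℕₚ.≤-trans le′ le))
bridge-cases true  false true  (s≤s z≤n) _ = refl , refl , refl
bridge-cases false true  false (s≤s z≤n) _ = refl , refl , refl

shift-or-bridge : ∀ {n} {K : Graph n} {u v v′} → TwoCut ((u , v) ∷ (v , v′) ∷ K) →
                  TwoCut ((u , v′) ∷ (v , v′) ∷ K) ⊎ Bridge K u v v′
shift-or-bridge {K = K} {u} {v} {v′} cut with TwoCut-or-cut ((u , v′) ∷ (v , v′) ∷ K)
... | inj₁ tec = inj₁ (TwoEdgeConnected⇒TwoCut tec)
... | inj₂ (X , a , b , Xa , Xb , le)
  with Bu , Bv′ , d≡0 ← bridge-cases (X u) (X v) (X v′) le (cut X a b Xa Xb) = inj₂ record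
  { B    = B
  ; Bu   = Bu
  ; Bv   = self (X v)
  ; Bv′  = Bv′
  ; none = trans (cong sum (map-cong (λ (a , b) → cr-xor (X a) (X b) (X v)) K)) d≡0
  }
  where
  -- The side of the violated cut that contains v.
  B : _ → Bool
  B a = not (X a xor X v)
  self : ∀ x → not (x xor x) ≡ true
  self true  = refl
  self false = refl

-- Splitting off: uv and vy are replaced by uy.  A cut Y violating the conclusion would separate v
-- from both u and y, but then it has an edge inside B and another one outside B or equal to vv′.
splitting-off : ∀ {n} {K : Graph n} {u v v′ y} (br : Bridge K u v v′) → Bridge.B br y ≡ true →
                TwoCut ((u , v) ∷ (v , y) ∷ (v , v′) ∷ K) → TwoCut ((u , y) ∷ (v , v′) ∷ K)
splitting-off {K = K} {u} {v} {v′} {y} br By cut Y a b Ya Yb =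
  cases (Y u) (Y v) (Y y) (Y v′) (cut Y a b Ya Yb) inside outside
    (total-+-≤ K λ {e} e∈ → local (B (proj₁ e)) (B (proj₂ e)) (Y (proj₁ e)) (Y (proj₂ e)) (Y v)
                                   (total≡0⁻ K none e∈))
  where
  open Bridge br
  -- `D` is the part of B that Y separates from v; `D′` is the part outside B on v's side of Y. No
  -- edge of K crosses B, so edges of K leaving `D` run inside B and those leaving `D′` run outside
  -- B.
  D D′ : _ → Bool
  D  a = B a ∧ (Y a xor Y v)
  D′ a = not (B a) ∧ not (Y a xor Y v)

  self : ∀ x → x xor x ≡ false
  self true  = refl
  self false = refl

  differ : ∀ {x z} → x ≡ not z → x xor z ≡ true
  differ {z = true}  refl = refl
  differ {z = false} refl = refl

  -- `D` contains y but none of u, v, v′: vy is the only listed edge leaving it, so K supplies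
  -- another.
  inside : Y y ≡ not (Y v) → 1 ≤ δ K D
  inside Yy = bound (cong (_∧ (Y u xor Y v)) Bu) Dv Dy (cong (_∧ (Y v′ xor Y v)) Bv′) (cut D y v Dy Dv)
    where
    Dv : D v ≡ false
    Dv = cong₂ _∧_ Bv (self (Y v))
    Dy : D y ≡ true
    Dy = cong₂ _∧_ By (differ Yy)
    bound : ∀ {du dv dy dv′ d} → du ≡ false → dv ≡ false → dy ≡ true → dv′ ≡ false →
            2 ≤ cr du dv + (cr dv dy + (cr dv dv′ + d)) → 1 ≤ d
    bound refl refl refl refl (s≤s p) = p

  -- `D′` contains v′ but none of u, v, y: here vv′ is the only listed edge leaving it.
  outside : Y u ≡ not (Y v) → Y v′ ≡ Y v → 1 ≤ δ K D′
  outside Yu Yv′ = bound D′u (D′-in Bv) (D′-in By) D′v′ (cut D′ v′ u D′v′ D′u)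
    where
    D′-in : ∀ {a} → B a ≡ true → D′ a ≡ false
    D′-in {a} Ba = cong (λ x → not x ∧ not (Y a xor Y v)) Ba
    D′u : D′ u ≡ false
    D′u = cong₂ (λ x z → not x ∧ not z) Bu (differ Yu)
    D′v′ : D′ v′ ≡ true
    D′v′ = cong₂ (λ x z → not x ∧ not z) Bv′ (trans (cong (_xor Y v) Yv′) (self (Y v)))
    bound : ∀ {du dv dy dv′ d} → du ≡ false → dv ≡ false → dy ≡ false → dv′ ≡ true →
            2 ≤ cr du dv + (cr dv dy + (cr dv dv′ + d)) → 1 ≤ d
    bound refl refl refl refl (s≤s p) = p

  local : ∀ ba bb ya yb yv → cr ba bb ≡ 0 →
          cr (ba ∧ (ya xor yv)) (bb ∧ (yb xor yv)) +
          cr (not ba ∧ not (ya xor yv)) (not bb ∧ not (yb xor yv)) ≤ cr ya yb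
  local true  true  true  true  true  _ = z≤n
  local true  true  true  true  false _ = z≤n
  local true  true  true  false true  _ = s≤s z≤n
  local true  true  true  false false _ = s≤s z≤n
  local true  true  false true  true  _ = s≤s z≤n
  local true  true  false true  false _ = s≤s z≤n
  local true  true  false false true  _ = z≤n
  local true  true  false false false _ = z≤n
  local false false true  true  true  _ = z≤n
  local false false true  true  false _ = z≤n
  local false false true  false true  _ = s≤s z≤n
  local false false true  false false _ = s≤s z≤n
  local false false false true  true  _ = s≤s z≤n
  local false false false true  false _ = s≤s z≤n
  local false false false false true  _ = z≤n
  local false false false false false _ = z≤n

  -- Splitting off loses crossings only if Y separates v from both u and y. If vv′ then crosses Y,
  -- one edge leaving `D` suffices; otherwise one from `D` and one from `D′` are combined.
  cases : ∀ yu yv yy yv′ {d i o} → 2 ≤ cr yu yv + (cr yv yy + (cr yv yv′ + d)) →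
          (yy ≡ not yv → 1 ≤ i) → (yu ≡ not yv → yv′ ≡ yv → 1 ≤ o) → i + o ≤ d →
          2 ≤ cr yu yy + (cr yv yv′ + d)
  cases true  true  true  _     h _ _ _ = h
  cases true  true  false _     h _ _ _ = h
  cases false false true  _     h _ _ _ = h
  cases false false false _     h _ _ _ = h
  cases true  false false _     h _ _ _ = h
  cases false true  true  _     h _ _ _ = h
  cases true  false true  false _ i o le = ℕₚ.≤-trans (ℕₚ.+-mono-≤ (i refl) (o refl refl)) le
  cases false true  false true  _ i o le = ℕₚ.≤-trans (ℕₚ.+-mono-≤ (i refl) (o refl refl)) le
  cases true  false true  true  _ i o le = s≤s (ℕₚ.≤-trans (i refl) (ℕₚ.≤-trans (ℕₚ.m≤m+n _ _) le))
  cases false true  false false _ i o le = s≤s (ℕₚ.≤-trans (i refl) (ℕₚ.≤-trans (ℕₚ.m≤m+n _ _) le))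

-- Paths in forests

Joins : ∀ {n} → Edge n → Fin n → Fin n → Set
Joins e a b = e ≡ (a , b) ⊎ e ≡ (b , a)

Adj⇒Joins : ∀ {n} {E : Graph n} {a b} → Adj E a b → ∃ λ e → e ∈ E × Joins e a b
Adj⇒Joins (inj₁ e∈) = _ , e∈ , inj₁ refl
Adj⇒Joins (inj₂ e∈) = _ , e∈ , inj₂ refl

Joins-endpoints : ∀ {n} {e : Edge n} {a b x y} → Joins e a b → Joins e x y → (x ≡ a × y ≡ b) ⊎ (x ≡ b × y ≡ a)
Joins-endpoints (inj₁ refl) (inj₁ refl) = inj₁ (refl , refl)
Joins-endpoints (inj₁ refl) (inj₂ refl) = inj₂ (refl , refl)
Joins-endpoints (inj₂ refl) (inj₁ refl) = inj₂ (refl , refl)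
Joins-endpoints (inj₂ refl) (inj₂ refl) = inj₁ (refl , refl)

Adj-removeAt : ∀ {n} {E : Graph n} {a b} i → Adj E a b → ¬ Joins (lookup E i) a b → Adj (removeAt E i) a b
Adj-removeAt i (inj₁ e) ¬j = inj₁ (∈-removeAt i e (¬j ∘ inj₁ ∘ sym))
Adj-removeAt i (inj₂ e) ¬j = inj₂ (∈-removeAt i e (¬j ∘ inj₂ ∘ sym))

forest⇒bridge : ∀ {n} {E : Graph n} → IsForest E → ∀ {a b} → Adj E a b →
                Σ (Fin (length E)) λ i → Joins (lookup E i) a b × ¬ Reach (removeAt E i) a b
forest⇒bridge {E = E} forest (inj₁ e) = index e , inj₁ (sym (lookup-index e)) ,
  subst (λ (x , y) → ¬ Reach (removeAt E (index e)) x y) (sym (lookup-index e)) (forest (index e))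
forest⇒bridge {E = E} forest (inj₂ e) = index e , inj₂ (sym (lookup-index e)) ,
  subst (λ (x , y) → ¬ Reach (removeAt E (index e)) x y) (sym (lookup-index e)) (forest (index e)) ∘ Reach-sym

forest⇒loopless : ∀ {n} {E : Graph n} → IsForest E → ∀ {a b} → Adj E a b → a ≢ b
forest⇒loopless forest ab refl with _ , _ , ¬r ← forest⇒bridge forest ab = ¬r Reach-refl

first∈ : ∀ {n} {E : Graph n} {a b vs} → Walk E a b vs → a ∈ vs
first∈ here       = here refl
first∈ (step _ _) = here refl

last∈ : ∀ {n} {E : Graph n} {a b vs} → Walk E a b vs → b ∈ vs
last∈ here       = here refl
last∈ (step _ w) = there (last∈ w)

-- Edge i has a as an end, so a walk that misses a never uses it.
avoiding⇒removeAt : ∀ {n} {E : Graph n} {x y vs} a i {b} → Joins (lookup E i) a b →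
                    Walk E x y vs → All (a ≢_) vs → Reach (removeAt E i) x y
avoiding⇒removeAt a i j here _ = Reach-refl
avoiding⇒removeAt a i j (step xy w) (a≢x ∷ a∉) =
  Reach-step (Adj-removeAt i xy λ j′ → [ a≢x ∘ sym ∘ proj₁ , All.lookup a∉ (first∈ w) ∘ sym ∘ proj₂ ]′ (Joins-endpoints j j′))
             (avoiding⇒removeAt a i j w a∉)

-- If the first steps lead to different nodes `b₁` and `b₂`, going along the second path and back
-- along the first joins a to `b₁` without the edge between them, which is a bridge.
path-unique : ∀ {n} {E : Graph n} → IsForest E → ∀ {a b vs ws} → Path E a b vs → Path E a b ws → vs ≡ ws
path-unique forest (here , _) (here , _) = refl
path-unique forest (here , _) (step _ w , a∉ ∷ _) = contradiction refl (All.lookup a∉ (last∈ w))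
path-unique forest (step _ w , a∉ ∷ _) (here , _) = contradiction refl (All.lookup a∉ (last∈ w))
path-unique forest {a} (step {b = b₁} ab₁ w₁ , a∉₁ ∷ u₁) (step {b = b₂} ab₂ w₂ , a∉₂ ∷ u₂) with b₁ ≟ b₂
... | yes refl = cong (a ∷_) (path-unique forest (w₁ , u₁) (w₂ , u₂))
... | no b₁≢b₂ with i , j , ¬r ← forest⇒bridge forest ab₁ = contradiction
  (Reach-step (Adj-removeAt i ab₂ λ j′ → [ b₁≢b₂ ∘ sym ∘ proj₂ , All.lookup a∉₂ (first∈ w₂) ∘ sym ∘ proj₂ ]′ (Joins-endpoints j j′))
    (Reach-trans (avoiding⇒removeAt a i j w₂ a∉₂) (Reach-sym (avoiding⇒removeAt a i j w₁ a∉₁))))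
  ¬r

path-from : ∀ {n} {E : Graph n} {a b c vs} → Path E b c vs → a ∈ vs → ∃ λ ws → Path E a c ws
path-from p@(here , _)              (here refl) = _ , p
path-from p@(step _ _ , _)          (here refl) = _ , p
path-from (step _ w , _ ∷ u)        (there a∈)  = path-from (w , u) a∈

Walk⇒Path : ∀ {n} {E : Graph n} {a b vs} → Walk E a b vs → ∃ λ ws → Path E a b ws
Walk⇒Path here = _ , here , [] ∷ []
Walk⇒Path {a = a} (step ab w) with ws , w′ , u ← Walk⇒Path w with Any.any? (a ≟_) ws
... | yes a∈ = path-from (w′ , u) a∈
... | no a∉  = a ∷ ws , step ab w′ , ¬Any⇒All¬ ws a∉ ∷ u

tail-SubPath : ∀ {n} {E : Graph n} {a b vs} → Walk E a b vs → ∀ x → SubPath vs (x ∷ vs)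
tail-SubPath {vs = _ ∷ _} _ x = All.tabulate there , All.tabulate (inj₁ ∘ there)

-- `PathIncl` quantifies over all paths; uniqueness reduces it to the two given ones.
tail-PathIncl : ∀ {n} {E : Graph n} → IsForest E → ∀ {v v′ s vs} → Path E v s (v ∷ vs) →
                Path E v′ s vs → PathIncl E v′ s v s
tail-PathIncl forest {v} p q _ _ p′ q′ =
  subst₂ SubPath (path-unique forest q p′) (path-unique forest p q′) (tail-SubPath (proj₁ q) v)

-- Degrees

inc : ∀ {n} → Fin n → Edge n → ℕ
inc x (a , b) = if ⌊ x ≟ a ⌋ ∨ ⌊ x ≟ b ⌋ then 1 else 0

deg≡total : ∀ {n} (E : Graph n) x → deg E x ≡ total (inc x) E
deg≡total []      x = refl
deg≡total (e ∷ E) x = cong (inc x e +_) (deg≡total E x)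

inc-left : ∀ {n} (a b : Fin n) → inc a (a , b) ≡ 1
inc-left a b with a ≟ a
... | yes _  = refl
... | no a≢a = contradiction refl a≢a

inc-right : ∀ {n} (a b : Fin n) → inc a (b , a) ≡ 1
inc-right a b with a ≟ b
... | yes _ = refl
... | no _ with a ≟ a
...   | yes _  = refl
...   | no a≢a = contradiction refl a≢a

Joins⇒inc : ∀ {n} {e} {a b : Fin n} → Joins e a b → inc a e ≡ 1
Joins⇒inc {a = a} {b} (inj₁ refl) = inc-left a b
Joins⇒inc {a = a} {b} (inj₂ refl) = inc-right a b

inc⇒Joins : ∀ {n} {a : Fin n} {e} → 1 ≤ inc a e → ∃ λ b → Joins e a b
inc⇒Joins {a = a} {x , y} le with a ≟ x
... | yes refl = y , inj₁ refl
... | no _ with a ≟ y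
...   | yes refl = x , inj₂ refl
...   | no _ with () ← le

crosses-Joins : ∀ {n} {X : Fin n → Bool} {e a b} → Joins e a b → crosses X e ≡ cr (X a) (X b)
crosses-Joins {X = X} {a = a} {b} (inj₁ refl) = refl
crosses-Joins {X = X} {a = a} {b} (inj₂ refl) = cr-sym (X b) (X a)

-- Isolates the edge that plays vv′. If a has degree 2, exactly one edge at a remains in `E₁`.
split-edge : ∀ {n} {E : Graph n} {a b} → Adj E a b → ∃ λ E₁ →
             E ≈ᶜ ((a , b) ∷ E₁) × deg E a ≡ suc (deg E₁ a) × (∀ {e} → e ∈ E₁ → e ∈ E)
split-edge {E = E} {a} {b} ab with e , e∈ , j ← Adj⇒Joins ab with E₁ , p ← ∈⇒↭∷ e∈ = E₁ ,
    ≈ᶜ-trans (↭⇒≈ᶜ p) (≈ᶜ-∷ (λ X → crosses-Joins {X = X} j) ≈ᶜ-refl) ,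
    trans (deg≡total E a) (trans (total-↭ (inc a) p) (cong₂ _+_ (Joins⇒inc j) (sym (deg≡total E₁ a)))) ,
    λ e∈ → ↭ₚ.∈-resp-↭ (↭-sym p) (there e∈)

-- If deg v = 2, then B ∖ {v} is non-empty and only one edge of the forest can leave it.
link-inside : ∀ {n} {E E₁ F : Graph n} {u v v′} → IsForest E → (∀ {e} → e ∈ E₁ → e ∈ E) → deg E₁ v ≡ 1 →
              (br : Bridge (E₁ ++ F) u v v′) → TwoCut ((u , v) ∷ (v , v′) ∷ E₁ ++ F) →
              ∃₂ λ e y → e ∈ F × Joins e v y × Bridge.B br y ≡ true
link-inside {n} {E} {E₁} {F} {u} {v} {v′} forest E₁⊆E dv br cut
  -- The other end w of the remaining forest edge at v lies in B, as that edge does not cross B;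
  -- hence `C` is non-empty.
  with e₁ , e₁∈ , inc₁ ← total-positive E₁ (ℕₚ.≤-reflexive (trans (sym dv) (deg≡total E₁ v)))
  with w , j₁ ← inc⇒Joins inc₁
  = found
  where
  open Bridge br
  C : Fin n → Bool
  C a = B a ∧ not ⌊ a ≟ v ⌋

  uncrossed : ∀ {e} → e ∈ E₁ ++ F → crosses B e ≡ 0
  uncrossed = total≡0⁻ (E₁ ++ F) none

  ∉C : ∀ {a} → B a ≡ false → C a ≡ false
  ∉C {a} Ba = cong (_∧ not ⌊ a ≟ v ⌋) Ba

  v∉C : C v ≡ false
  v∉C with v ≟ v
  ... | yes _  = cong (_∧ false) Bv
  ... | no v≢v = contradiction refl v≢v

  w∈C : C w ≡ true
  w∈C with w ≟ v
  ... | yes refl = contradiction refl (forest⇒loopless forest {v} {v}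
                     (Sum.map (λ { refl → E₁⊆E e₁∈ }) (λ { refl → E₁⊆E e₁∈ }) j₁))
  ... | no _ = cong (_∧ true) (trans (sym (cr≡0⇒≡ (B v) (B w)
                 (trans (sym (crosses-Joins {X = B} j₁)) (uncrossed (∈-++⁺ˡ e₁∈))))) Bv)

  -- An edge that does not cross B can leave B without v only by ending at v.
  C-crossing : ∀ {e} → crosses B e ≡ 0 → 1 ≤ crosses C e → ∃ λ y → Joins e v y × B y ≡ true
  C-crossing {a , b} eq le with a ≟ v | b ≟ v
  ... | yes refl | yes refl with () ← subst (1 ≤_) (cr-self (B v ∧ false)) le
  ... | yes refl | no _     = b , inj₁ refl , trans (sym (cr≡0⇒≡ (B v) (B b) eq)) Bv
  ... | no _     | yes refl = a , inj₂ refl , trans (cr≡0⇒≡ (B a) (B v) eq) Bv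
  ... | no _     | no _ with () ← subst (1 ≤_)
    (trans (cong (λ x → cr (x ∧ true) (B b ∧ true)) (cr≡0⇒≡ (B a) (B b) eq)) (cr-self (B b ∧ true))) le

  C≤inc : ∀ {e} → e ∈ E₁ → crosses C e ≤ inc v e
  C≤inc {e} e∈ with crosses C e in eq
  ... | zero  = z≤n
  ... | suc _ with _ , j , _ ← C-crossing (uncrossed (∈-++⁺ˡ e∈)) (subst (1 ≤_) (sym eq) (s≤s z≤n)) =
    subst₂ _≤_ eq (sym (Joins⇒inc j)) (cr≤1 (C (proj₁ e)) (C (proj₂ e)))

  bound : ∀ {cu cv cv′ d₁ d} → cu ≡ false → cv ≡ false → cv′ ≡ false → d₁ ≤ 1 →
          2 ≤ cr cu cv + (cr cv cv′ + (d₁ + d)) → 1 ≤ d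
  bound refl refl refl z≤n       le       = ℕₚ.≤-trans (s≤s z≤n) le
  bound refl refl refl (s≤s z≤n) (s≤s le) = le

  -- At least two edges leave `C`. Neither uv nor vv′ does, and the forest contributes at most its
  -- single edge at v, so some link must.
  δFC : 1 ≤ δ F C
  δFC = bound (∉C Bu) v∉C (∉C Bv′)
    (ℕₚ.≤-trans (total-mono E₁ C≤inc) (ℕₚ.≤-reflexive (trans (sym (deg≡total E₁ v)) dv)))
    (subst (λ d → 2 ≤ crosses C (u , v) + (crosses C (v , v′) + d)) (total-++ (crosses C) E₁ F)
      (cut C w v w∈C v∉C))

  found : ∃₂ λ e y → e ∈ F × Joins e v y × B y ≡ true
  found with e , e∈ , le ← total-positive F δFC
        with y , j , By ← C-crossing (uncrossed (∈-++⁺ʳ E₁ e∈)) le = e , y , e∈ , j , By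

Bridge-⊆ : ∀ {n} {K K′ : Graph n} {u v v′} → (∀ {e} → e ∈ K′ → e ∈ K) → Bridge K u v v′ → Bridge K′ u v v′
Bridge-⊆ {K = K} {K′} K′⊆K br = record
  { B = B ; Bu = Bu ; Bv = Bv ; Bv′ = Bv′ ; none = total≡0 K′ (total≡0⁻ K none ∘ K′⊆K) }
  where open Bridge br

-- Finite search for an optimal solution

lists : {A : Set} → List A → ℕ → List (List A)
lists xs zero    = [] ∷ []
lists xs (suc k) = [] ∷ cartesianProductWith _∷_ xs (lists xs k)

∈-lists : {A : Set} {xs ys : List A} {k : ℕ} → All (_∈ xs) ys → length ys ≤ k → ys ∈ lists xs k
∈-lists {k = zero}  []        _        = here refl
∈-lists {k = suc k} []        _        = here refl
∈-lists {k = suc k} (y∈ ∷ ys) (s≤s le) = there (∈-cartesianProductWith⁺ _∷_ y∈ (∈-lists ys le))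

-- Every link weighs at least 1. This bounds the number of links of a feasible solution by p and
-- makes the search finite.
length≤weight : ∀ {n p} {F : List (Link n)} → All (ValidLink p) F → length F ≤ weight F
length≤weight []                    = z≤n
length≤weight ((_ , 1≤t , _) ∷ val) = ℕₚ.+-mono-≤ 1≤t (length≤weight val)

weight-↭ : ∀ {n} {F F′ : List (Link n)} → F ↭ F′ → weight F ≡ weight F′
weight-↭ ↭.refl = refl
weight-↭ (↭.prep (_ , _ , t) p) = cong (t +_) (weight-↭ p)
weight-↭ (↭.swap (_ , _ , t) (_ , _ , s) p) = trans (x∙yz≈y∙xz t s _) (cong (λ w → s + (t + w)) (weight-↭ p))
weight-↭ (↭.trans p q) = trans (weight-↭ p) (weight-↭ q)

module _ (CM : CostMonoid) where
  private module C = CostMonoid CM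

  ⊕-swap : ∀ x y z → (x C.⊕ (y C.⊕ z)) ≡ (y C.⊕ (x C.⊕ z))
  ⊕-swap x y z = trans (sym (C.⊕-assoc x y z)) (trans (cong (C._⊕ z) (C.⊕-comm x y)) (C.⊕-assoc y x z))

  ≡⇒≼ : ∀ {x y} → x ≡ y → x C.≼ y
  ≡⇒≼ refl = C.≼-refl _

  argmin : {A : Set} (f : A → C.Carrier) (x : A) (xs : List A) →
           ∃ λ y → y ∈ x ∷ xs × All (λ z → f y C.≼ f z) (x ∷ xs)
  argmin f x [] = x , here refl , C.≼-refl (f x) ∷ []
  argmin f x (x′ ∷ xs) with y , y∈ , min ← argmin f x′ xs with C.≼-total (f x) (f y)
  ... | inj₁ x≼y = x , here refl , C.≼-refl (f x) ∷ All.map (C.≼-trans x≼y) min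
  ... | inj₂ y≼x = y , there y∈ , y≼x ∷ min

  cost-↭ : ∀ {n} (c : CostFn CM n) {F F′ : List (Link n)} → F ↭ F′ → cost CM c F ≡ cost CM c F′
  cost-↭ c ↭.refl = refl
  cost-↭ c (↭.prep (a , b , t) p) = cong (c a b t C.⊕_) (cost-↭ c p)
  cost-↭ c (↭.swap (a , b , t) (a′ , b′ , t′) p) =
    trans (⊕-swap (c a b t) (c a′ b′ t′) _) (cong (λ w → c a′ b′ t′ C.⊕ (c a b t C.⊕ w)) (cost-↭ c p))
  cost-↭ c (↭.trans p q) = trans (cost-↭ c p) (cost-↭ c q)

validLink? : ∀ {n} p (ℓ : Link n) → Dec (ValidLink p ℓ)
validLink? p (a , b , t) = ¬? (a ≟ b) ×-dec (1 ≤? t) ×-dec (t ≤? p)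

feasible? : ∀ {n} p (E : Graph n) F → Dec (Feasible p E F)
feasible? p E F = All.all? (validLink? p) F ×-dec (weight F ≤? p) ×-dec twoEdgeConnected? (E ++ map linkEdge F)

module _ (CM : CostMonoid) {n : ℕ} (p : ℕ) (E : Graph n) (c : CostFn CM n) where
  private module C = CostMonoid CM

  optimal-exists : ∃ (Feasible p E) → ∃ (Optimal CM p E c)
  optimal-exists (F₀ , feas₀) = best (argmin CM (cost CM c) F₀ candidates)
    where
    links : List (Link n)
    links = cartesianProduct (allFin n) (cartesianProduct (allFin n) (upTo (suc p)))
    candidates : List (List (Link n))
    -- The given `F₀` is put in front of this list later, so that `argmin` has a non-empty list to
    -- work on.
    candidates = filter (feasible? p E) (lists links p)
    listed : ∀ {F} → Feasible p E F → F ∈ lists links p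
    listed (valid , light , _) = ∈-lists
      (All.map (λ { {a , b , t} (_ , _ , t≤p) →
        ∈-cartesianProduct⁺ (∈-allFin a) (∈-cartesianProduct⁺ (∈-allFin b) (∈-upTo⁺ (s≤s t≤p))) }) valid)
      (ℕₚ.≤-trans (length≤weight valid) light)
    feasible : ∀ {F} → F ∈ F₀ ∷ candidates → Feasible p E F
    feasible (here refl) = feas₀
    feasible (there F∈)  = proj₂ (∈-filter⁻ (feasible? p E) {xs = lists links p} F∈)
    best : (∃ λ F → F ∈ F₀ ∷ candidates × All (λ F′ → cost CM c F C.≼ cost CM c F′) (F₀ ∷ candidates)) →
           ∃ (Optimal CM p E c)
    best (F , F∈ , min) = F , feasible F∈ , λ F′ feas′ →
      All.lookup min (there (∈-filter⁺ (feasible? p E) (listed feas′) feas′))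

  -- Modifications that preserve optimality

  Opt : List (Link n) → Set
  Opt = Optimal CM p E c

  Opt⇒valid : ∀ {F} → Opt F → All (ValidLink p) F
  Opt⇒valid ((valid , _) , _) = valid

  Opt⇒TwoCut : ∀ {F} → Opt F → TwoCut (E ++ map linkEdge F)
  Opt⇒TwoCut ((_ , _ , tec) , _) = TwoEdgeConnected⇒TwoCut tec

  Opt-replace : ∀ {F F′} → Opt F → All (ValidLink p) F′ → weight F′ ≤ weight F →
                TwoCut (E ++ map linkEdge F′) → cost CM c F′ C.≼ cost CM c F → Opt F′
  Opt-replace ((_ , light , _) , min) valid′ w≤ cut′ c≤ =
    (valid′ , ℕₚ.≤-trans w≤ light , TwoCut⇒TwoEdgeConnected cut′) , λ F″ feas → C.≼-trans c≤ (min F″ feas)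

  Opt-↭ : ∀ {F F′} → F ↭ F′ → Opt F → Opt F′
  Opt-↭ perm opt = Opt-replace opt (↭ₚ.All-resp-↭ perm (Opt⇒valid opt)) (ℕₚ.≤-reflexive (weight-↭ (↭-sym perm)))
    (TwoCut-resp (↭⇒≈ᶜ (↭ₚ.++⁺ˡ E (↭ₚ.map⁺ linkEdge perm))) (Opt⇒TwoCut opt))
    (≡⇒≼ CM (cost-↭ CM c (↭-sym perm)))

  module _ (c-sym : SymmetricCost CM p c) where

    -- Links are stored as ordered pairs; this lets a chosen endpoint be written first.
    Opt-flip : ∀ {a b t F} → Opt ((a , b , t) ∷ F) → Opt ((b , a , t) ∷ F)
    Opt-flip {a} {b} {t} {F} opt with v@(a≢b , t-range) ∷ valid ← Opt⇒valid opt =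
      Opt-replace opt ((a≢b ∘ sym , t-range) ∷ valid) ℕₚ.≤-refl
        (TwoCut-resp (≈ᶜ-trans (≈ᶜ-front (≈ᶜ-refl {G = E}) (a , b) (map linkEdge F))
          (≈ᶜ-trans (≈ᶜ-∷ (λ X → cr-sym (X a) (X b)) ≈ᶜ-refl)
            (≈ᶜ-sym (≈ᶜ-front (≈ᶜ-refl {G = E}) (b , a) (map linkEdge F))))) (Opt⇒TwoCut opt))
        (≡⇒≼ CM (cong (C._⊕ cost CM c F) (sym (c-sym a b t v))))

    Shorter : ℕ → Set
    Shorter k = ∃ λ F → Opt F × length F < k

    module _ (forest : IsForest E) (triangle : Triangle CM p c) where

      -- The triangle inequality pays for the new link, and its weight `t + t′` leaves the total
      -- weight unchanged.
      merge : ∀ {u v v′ y t t′ E₁ F} → E ≈ᶜ ((v , v′) ∷ E₁) →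
              (br : Bridge (E₁ ++ map linkEdge F) u v v′) → Bridge.B br y ≡ true →
              Opt ((v , y , t′) ∷ (u , v , t) ∷ F) → Opt ((u , y , t + t′) ∷ F)
      merge {u} {v} {v′} {y} {t} {t′} {E₁} {F} E≈ br By opt
        with v₁@(v≢y , 1≤t′ , t′≤p) ∷ v₂@(u≢v , 1≤t , t≤p) ∷ valid ← Opt⇒valid opt =
        Opt-replace opt (v₃ ∷ valid)
          (ℕₚ.≤-reflexive (trans (ℕₚ.+-assoc t t′ (weight F)) (x∙yz≈y∙xz t t′ (weight F))))
          (TwoCut-resp (≈ᶜ-sym (≈ᶜ-front E≈ (u , y) (map linkEdge F)))
            (splitting-off br By
              (TwoCut-resp (↭⇒≈ᶜ (↭ₚ.shift (u , v) ((v , y) ∷ (v , v′) ∷ E₁) (map linkEdge F)))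
                (TwoCut-resp (≈ᶜ-front E≈ (v , y) ((u , v) ∷ map linkEdge F)) (Opt⇒TwoCut opt)))))
          (C.≼-trans (C.⊕-mono (triangle u v y t t′ (t + t′) v₂ v₁ v₃ ℕₚ.≤-refl) (C.≼-refl _))
            (≡⇒≼ CM (trans (C.⊕-assoc _ _ _) (⊕-swap CM _ _ _))))
        where
        u≢y : u ≢ y
        u≢y refl with () ← trans (sym (Bridge.Bu br)) By
        -- Both old links belong to one feasible solution, so their weights together stay within p.
        v₃ : ValidLink p (u , y , t + t′)
        v₃ = u≢y , ℕₚ.≤-trans 1≤t (ℕₚ.m≤m+n t t′) , (begin
          t + t′              ≡⟨ ℕₚ.+-comm t t′ ⟩
          t′ + t              ≤⟨ ℕₚ.+-monoʳ-≤ t′ (ℕₚ.m≤m+n t (weight F)) ⟩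
          t′ + (t + weight F) ≤⟨ proj₁ (proj₂ (proj₁ opt)) ⟩
          p                   ∎)
          where open ℕₚ.≤-Reasoning

      -- The first alternative concerns connectivity only. The cost of the shifted link, and the
      -- case v′ = u, are left to `process`.
      shift-or-merge : ∀ {u v v′ t F} → Adj E v v′ → deg E v ≡ 2 → Opt ((u , v , t) ∷ F) →
                       TwoCut (E ++ (u , v′) ∷ map linkEdge F) ⊎ Shorter (suc (length F))
      shift-or-merge {u} {v} {v′} {t} {F} vv′ deg≡2 opt
        with E₁ , E≈ , deg≡ , E₁⊆E ← split-edge vv′
        with cut ← TwoCut-resp (≈ᶜ-front E≈ (u , v) (map linkEdge F)) (Opt⇒TwoCut opt)
        with shift-or-bridge cut
      ... | inj₁ cut′ = inj₁ (TwoCut-resp (≈ᶜ-sym (≈ᶜ-front E≈ (u , v′) (map linkEdge F))) cut′)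
      ... | inj₂ br
        with e , y , e∈ , j , By ← link-inside forest E₁⊆E (ℕₚ.suc-injective (trans (sym deg≡) deg≡2)) br cut
        with (a , b , t′) , ℓ∈ , refl ← ∈-map⁻ linkEdge e∈
        with F₂ , perm ← ∈⇒↭∷ ℓ∈
        = inj₂ ((u , y , t + t′) ∷ F₂ ,
                merge E≈ (Bridge-⊆ F₂⊆F br) By (orient j (Opt-↭ (↭.trans (↭.prep _ perm) (↭.swap _ _ ↭.refl)) opt)) ,
                s≤s (ℕₚ.≤-reflexive (sym (↭ₚ.↭-length perm))))
        where
        F₂⊆F : ∀ {e} → e ∈ E₁ ++ map linkEdge F₂ → e ∈ E₁ ++ map linkEdge F
        F₂⊆F = ↭ₚ.∈-resp-↭ (↭ₚ.++⁺ˡ E₁ (↭ₚ.map⁺ linkEdge (↭-sym perm))) ∘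
               [ ∈-++⁺ˡ , ∈-++⁺ʳ E₁ ∘ there ]′ ∘ ∈-++⁻ E₁
        orient : ∀ {a b y t G} → Joins (a , b) v y → Opt ((a , b , t) ∷ G) → Opt ((v , y , t) ∷ G)
        orient (inj₁ refl) o = o
        orient (inj₂ refl) o = Opt-flip o

      -- Shortening the links at the leaf u

      module _ (S : Fin n → ℕ → Fin n → Fin n) (S-choice : IsSChoice CM p E c S)
               (internal : ShadowInternal CM p E c) (external : ShadowExternal CM p E c S)
               (u : Fin n) (leaf : Leaf E u) where

        -- The end of P(f), respectively P_u(f), towards which the link f = (u , v) of weight t is shortened.
        Target : Fin n → ℕ → Fin n → Set
        Target v t s = (Reach E u v × s ≡ u) ⊎ (¬ Reach E u v × s ≡ S u t v)

        target : ∀ {v t} → ValidLink p (u , v , t) → ∃ λ s → Target v t s × Reach E v s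
        target {v} {t} (_ , 1≤t , t≤p) with reach? E u v
        ... | yes r = u , inj₁ (r , refl) , Reach-sym r
        ... | no ¬r = S u t v , inj₂ (¬r , refl) , proj₁ (proj₂ (S-choice u v t leaf ¬r 1≤t t≤p))

        -- `S u t` is constant on components, so moving along a forest edge keeps the target.
        Target-step : ∀ {v v′ t s} → ValidLink p (u , v , t) → Adj E v v′ → Target v t s → Target v′ t s
        Target-step _ vv′ (inj₁ (r , eq)) = inj₁ (Reach-trans r (Reach-step vv′ Reach-refl) , eq)
        Target-step {v} {v′} {t} (_ , 1≤t , t≤p) vv′ (inj₂ (¬r , eq)) =
          inj₂ (¬r ∘ (λ r → Reach-trans r (Reach-step (Adj-sym {E = E} vv′) Reach-refl)) ,
                trans eq (proj₁ (S-choice u v t leaf ¬r 1≤t t≤p) v′ (Reach-step vv′ Reach-refl)))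

        shortened-cost : ∀ {v v′ t s} → ValidLink p (u , v , t) → ValidLink p (u , v′ , t) → Adj E v v′ →
                         Target v t s → PathIncl E v′ s v s → c u v′ t C.≼ c u v t
        shortened-cost {v} {v′} {t} val@(u≢v , ts) val′@(u≢v′ , ts′) vv′ (inj₁ (r , refl)) incl =
          -- The path inclusion has u as its second end, so both links are read in reverse.
          subst₂ C._≼_ (sym (c-sym u v′ t val′)) (sym (c-sym u v t val))
            (internal v u v′ u t t (u≢v ∘ sym , ts) (u≢v′ ∘ sym , ts′) ℕₚ.≤-refl (Reach-sym r)
              (Reach-sym (Reach-trans r adj)) adj incl)
          where
          adj : Reach E v v′
          adj = Reach-step vv′ Reach-refl
        shortened-cost {v} {v′} {t} val@(_ , 1≤t , t≤p) _ vv′ tgt@(inj₂ (¬r , refl)) incl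
          with Target-step val vv′ tgt
        ... | inj₁ (r , _) = contradiction (Reach-trans r (Reach-step (Adj-sym {E = E} vv′) Reach-refl)) ¬r
        ... | inj₂ (¬r′ , eq) = external u v v′ t t leaf ¬r ¬r′ 1≤t ℕₚ.≤-refl t≤p
                                  (subst (λ s → PathIncl E v′ s v (S u t v)) eq incl)

        Good : Fin n → Set
        Good v = InR E v ⊎ InSu p E S u v

        -- Recursion along the path from v to its target. It stops at the target, at a node of
        -- degree other than 2, or as soon as a solution with fewer links appears.
        process : ∀ {v s vs t F} → Walk E v s vs → Unique vs → Target v t s → Opt ((u , v , t) ∷ F) →
                  Shorter (suc (length F)) ⊎ ∃ λ v′ → Good v′ × Opt ((u , v′ , t) ∷ F)
        process {v} {t = t} here _ tgt opt with (u≢v , 1≤t , t≤p) ∷ _ ← Opt⇒valid opt with tgt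
        -- An internal link has u as target; reaching it would make the link a loop.
        ... | inj₁ (_ , v≡u) = contradiction (sym v≡u) u≢v
        ... | inj₂ (¬r , v≡S) = inj₂ (v , inj₂ (t , v , 1≤t , t≤p , ¬r , v≡S) , opt)
        process {v} {s} {t = t} {F} (step {b = v′} vv′ w) (v∉ ∷ uniq) tgt opt with deg E v ℕₚ.≟ 2
        ... | no ≢2 = inj₂ (v , inj₁ ≢2 , opt)
        ... | yes ≡2 with shift-or-merge vv′ ≡2 opt
        ...   | inj₂ shorter = inj₁ shorter
        ...   | inj₁ cut with val@(_ , t-range) ∷ valid ← Opt⇒valid opt with u ≟ v′
        ...     | no u≢v′ = process w uniq (Target-step val vv′ tgt)
          (Opt-replace opt ((u≢v′ , t-range) ∷ valid) ℕₚ.≤-refl cut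
            (C.⊕-mono (shortened-cost val (u≢v′ , t-range) vv′ tgt
                        (tail-PathIncl forest (step vv′ w , v∉ ∷ uniq) (w , uniq)))
                      (C.≼-refl _)))
        -- The shifted link would be a loop at u. It crosses no cut, so it is dropped, and costs are
        -- at least `𝟘`.
        ...     | yes refl = inj₁ (F , Opt-replace opt valid (ℕₚ.m≤n+m (weight F) t)
          (TwoCut-resp (≈ᶜ-trans (≈ᶜ-front (≈ᶜ-refl {G = E}) (u , u) (map linkEdge F))
                                 (same-cuts {H = E ++ map linkEdge F} λ X → cong (_+ δ (E ++ map linkEdge F) X) (cr-self (X u)))) cut)
          (C.≼-trans (≡⇒≼ CM (sym (C.⊕-identityˡ _))) (C.⊕-mono (C.𝟘-least _) (C.≼-refl _))) ,
          ℕₚ.n<1+n (length F))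

        Improved : List (Link n) → Set
        Improved F = Shorter (suc (length F)) ⊎ ∃ λ ℓ → GoodAt p E S u ℓ × Opt (ℓ ∷ F)

        process-leaf-link : ∀ {v t F} → Opt ((u , v , t) ∷ F) → Improved F
        process-leaf-link opt
          with val ∷ _ ← Opt⇒valid opt
          with s , tgt , _ , w ← target val
          with _ , w′ , uniq ← Walk⇒Path w
          with process w′ uniq tgt opt
        ... | inj₁ shorter = inj₁ shorter
        ... | inj₂ (v′ , good , opt′) with (u≢v′ , _) ∷ _ ← Opt⇒valid opt′ =
          inj₂ (_ , ((λ _ → good) , λ v′≡u → contradiction (sym v′≡u) u≢v′) , opt′)

        process-link : ∀ ℓ {F} → Opt (ℓ ∷ F) → Improved F
        process-link (a , b , t) opt with a ≟ u | b ≟ u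
        ... | yes refl | _        = process-leaf-link opt
        ... | no _     | yes refl = process-leaf-link (Opt-flip opt)
        ... | no a≢u   | no b≢u   = inj₂ (_ , ((λ a≡u → contradiction a≡u a≢u) , λ b≡u → contradiction b≡u b≢u) , opt)

        -- `F` holds the links still to be treated and `G` the good ones. A shorter solution
        -- restarts with everything untreated and a smaller bound k; otherwise one link moves from
        -- `F` to `G`.
        improve : ∀ k F G → All (GoodAt p E S u) G → Opt (F ++ G) → length (F ++ G) ≤ k →
                  ∃ λ F → Opt F × All (GoodAt p E S u) F
        improve k [] G good opt _ = G , opt , good
        improve k (ℓ ∷ F) G good opt le with process-link ℓ opt
        improve (suc k) (_ ∷ _) _ _ _ (s≤s le) | inj₁ (F′ , opt′ , s≤s F′≤) =
          improve k F′ [] [] (subst Opt (sym (++-identityʳ F′)) opt′)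
            (subst (λ F → length F ≤ k) (sym (++-identityʳ F′)) (ℕₚ.≤-trans F′≤ le))
        improve k (_ ∷ F) G good _ le | inj₂ (ℓ′ , good′ , opt′) =
          improve k F (ℓ′ ∷ G) (good′ ∷ good) (Opt-↭ (↭-sym (↭ₚ.shift ℓ′ F G)) opt′)
            (ℕₚ.≤-trans (ℕₚ.≤-reflexive (↭ₚ.↭-length (↭ₚ.shift ℓ′ F G))) le)

theorem10 : (CM : CostMonoid) (n p : ℕ) → 1 ≤ p →
    (E : Graph n) → IsForest E →
    (Σ (Fin n) λ x → Σ (Fin n) λ y → ¬ Reach E x y) →
    (c : CostFn CM n) → SymmetricCost CM p c →
    (S : Fin n → ℕ → Fin n → Fin n) → IsSChoice CM p E c S →
    IsMetric CM p E c S →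
    (u : Fin n) → Leaf E u →
    (∃ λ F → Feasible p E F) →
    ∃ λ (F : List (Link n)) → Optimal CM p E c F × All (GoodAt p E S u) F
theorem10 CM n p _ E forest _ c c-sym S S-choice (internal , external , triangle) u leaf feasible
  with F , opt ← optimal-exists CM p E c feasible =
  improve CM p E c c-sym forest triangle S S-choice internal external u leaf (length F) F [] []
    (subst (Optimal CM p E c) (sym (++-identityʳ F)) opt)
    (ℕₚ.≤-reflexive (cong length (++-identityʳ F)))
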